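{- Let $\mathbb{F}$ be a field and $n,d\ge 1$. Let $X^1,\dots,X^d$ be pairwise disjoint sets of $n^2$ variables each, $X^i=\{x^i_{jk}: j,k\in[n]\}$, and let $A^i$ be the $n\times n$ matrix with $(j,k)$ entry $x^i_{jk}$. Let $f\in\mathbb{F}[X^1\cup\dots\cup X^d]$ be the $(1,1)$ entry of the product $A^1A^2\cdots A^d$. Then any homogeneous $\Sigma\Pi\Sigma$ circuit computing the product of these $d$ matrices (i.e., computing the output polynomial $f$) has size $\Omega(n^{d-1}/2^d)$.
   Context: An arithmetic circuit over $\mathbb{F}$ is a directed acyclic graph whose in-degree-0 gates are labelled by variables or field constants and whose internal gates are plus or product gates; its size is its number of gates. A $\Sigma\Pi\Sigma$ circuit is a levelled depth-3 circuit with a single plus gate at the top, product gates at the middle level and plus gates at the bottom level, so it computes $\sum_{i=1}^k\prod_{j=1}^{\deg(P_i)} l_{i,j}$ with affine forms $l_{i,j}$; $k$ is the top fan-in. It is homogeneous if every bottom plus gate computes a homogeneous linear form. The paper studies the product of matrices through the single output polynomial given by the $(1,1)$ entry. -}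

module Defs where

open import Algebra.Apartness.Bundles using (HeytingField)
open import Data.Fin.Base using (Fin; combine; fromℕ<)
open import Data.Fin.Properties using (_≟_)
open import Data.List.Base as List using (List; []; _∷_; _++_)
open import Data.List.NonEmpty.Base as List⁺ using (List⁺)
open import Data.Nat.Base as ℕ using (ℕ)
open import Data.Product.Base using (_×_; _,_)
open import Data.Sum.Base using (_⊎_; [_,_]′)
open import Data.Vec.Base as Vec using (Vec)
open import Data.Vec.Functional using (Vector; foldr)
open import Data.Vec.Properties using (≡-dec)
open import Data.Bool.Base using (if_then_else_)
open import Relation.Binary.PropositionalEquality using (_≢_)
open import Relation.Nullary.Decidable using (does)
import Data.Nat.Properties as ℕₚ

-- Exponent vectors in N variables.
Monomial : ℕ → Set
Monomial N = Vec ℕ N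

module _ {c ℓ₁ ℓ₂} (F : HeytingField c ℓ₁ ℓ₂) where

  open HeytingField F using (Carrier; _≈_; 0#; 1#) renaming (_+_ to _+F_; _*_ to _*F_)

  -- The ring F[x₀,…,x_{N-1}]: a polynomial is a finite list of terms, possibly
  -- with repeated monomials or zero coefficients; the polynomial equality is
  -- _≈ₚ_ below, which compares coefficients, not propositional equality.
  Poly : ℕ → Set c
  Poly N = List (Carrier × Monomial N)

  coeff : ∀ {N} → Poly N → Monomial N → Carrier
  coeff []            m = 0#
  coeff ((a , e) ∷ p) m = if does (≡-dec ℕₚ._≟_ e m) then a +F coeff p m else coeff p m

  infix 4 _≈ₚ_
  _≈ₚ_ : ∀ {N} → Poly N → Poly N → Set ℓ₁
  p ≈ₚ q = ∀ m → coeff p m ≈ coeff q m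

  constₚ : ∀ {N} → Carrier → Poly N
  constₚ {N} a = (a , Vec.replicate N 0) ∷ []

  varₚ : ∀ {N} → Fin N → Poly N
  varₚ v = (1# , Vec.tabulate (λ w → if does (v ≟ w) then 1 else 0)) ∷ []

  0ₚ 1ₚ : ∀ {N} → Poly N
  0ₚ = []
  1ₚ = constₚ 1#

  infixl 6 _+ₚ_
  _+ₚ_ : ∀ {N} → Poly N → Poly N → Poly N
  _+ₚ_ = _++_

  infixl 7 _*ₚ_
  _*ₚ_ : ∀ {N} → Poly N → Poly N → Poly N
  _*ₚ_ = List.cartesianProductWith λ (a , e) (b , e′) → a *F b , Vec.zipWith ℕ._+_ e e′

  sumₚ productₚ : ∀ {N} → List (Poly N) → Poly N
  sumₚ     = List.foldr _+ₚ_ 0ₚ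
  productₚ = List.foldr _*ₚ_ 1ₚ

  -- The zero polynomial counts as a homogeneous linear form.
  IsHomogeneousLinear : ∀ {N} → Poly N → Set ℓ₁
  IsHomogeneousLinear p = ∀ m → Vec.sum m ≢ 1 → coeff p m ≈ 0#

  -- Gates are shared: a gate may feed any number of gates of the next level,
  -- and parallel wires are allowed.  Wires into a bottom plus gate carry
  -- scalars, so that these gates compute arbitrary affine forms.
  record ΣΠΣCircuit (N : ℕ) : Set c where
    field
      #inputs #sums #products : ℕ
      label  : Fin #inputs → Fin N ⊎ Carrier
      bottom : Fin #sums → List⁺ (Carrier × Fin #inputs)
      middle : Fin #products → List⁺ (Fin #sums)
      top    : List⁺ (Fin #products)

    size : ℕ
    size = #inputs ℕ.+ #sums ℕ.+ #products ℕ.+ 1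

    inputValue : Fin #inputs → Poly N
    inputValue i = [ varₚ , constₚ ]′ (label i)

    bottomValue : Fin #sums → Poly N
    bottomValue s =
      sumₚ (List.map (λ (a , i) → constₚ a *ₚ inputValue i) (List⁺.toList (bottom s)))

    middleValue : Fin #products → Poly N
    middleValue p = productₚ (List.map bottomValue (List⁺.toList (middle p)))

    output : Poly N
    output = sumₚ (List.map middleValue (List⁺.toList top))

    Homogeneous : Set ℓ₁
    Homogeneous = ∀ s → IsHomogeneousLinear (bottomValue s)

    Computes : Poly N → Set ℓ₁
    Computes f = output ≈ₚ f

  Matrix : ℕ → ℕ → Set c
  Matrix n N = Fin n → Fin n → Poly N

  1ₘ : ∀ {n N} → Matrix n N
  1ₘ i j = if does (i ≟ j) then 1ₚ else 0ₚ

  infixl 7 _*ₘ_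
  _*ₘ_ : ∀ {n N} → Matrix n N → Matrix n N → Matrix n N
  (A *ₘ B) i j = foldr _+ₚ_ 0ₚ (λ k → A i k *ₚ B k j)

  matrixProduct : ∀ {n N d} → Vector (Matrix n N) d → Matrix n N
  matrixProduct = foldr _*ₘ_ 1ₘ

  -- The d · n² variables xⁱⱼₖ are numbered by the bijection
  -- (i , j , k) ↦ combine i (combine j k).
  variableMatrix : ∀ n d → Fin d → Matrix n (d ℕ.* (n ℕ.* n))
  variableMatrix n d i j k = varₚ (combine i (combine j k))

  -- Index (1,1) in 1-based notation is index (0,0) of Fin n.
  matrixProduct₁₁ : ∀ n d → 1 ℕ.≤ n → Poly (d ℕ.* (n ℕ.* n))
  matrixProduct₁₁ n d 1≤n = matrixProduct (variableMatrix n d) (fromℕ< 1≤n) (fromℕ< 1≤n)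

-- Nisan–Wigderson rank argument.  Index rows and columns by the n^(d-1) closed
-- walks of length d based at vertex 1, and let the (w , w′) entry be the
-- coefficient of the monomial that agrees with w on the odd layers and with w′
-- on the even ones.  Each half of the layers already visits every vertex of a
-- walk, so for f this is the identity matrix.  For a product of d homogeneous
-- linear forms, splitting every form into its odd and even parts exhibits the
-- matrix as a sum of 2^d matrices of rank one, and a product of any other number
-- of forms has no monomial of degree d.  Hence n^(d-1) ≤ #products * 2^d, and
-- ε = 1 works.

module Submission where

open import Defs
open import Algebra.Apartness.Bundles using (HeytingField; HeytingCommutativeRing)
open import Algebra.Bundles using (CommutativeRing)
open import Data.Bool.Base using (Bool; true; false; not; if_then_else_)
open import Data.Fin.Base using (Fin; zero; suc; combine; fromℕ<; punchIn; remQuot; _↑ˡ_; _↑ʳ_)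
import Data.Fin.Properties as Fin
open import Data.Integer.Base as ℤ using (+_)
import Data.Integer.Properties as ℤₚ
open import Data.List.Base as List using (List; []; _∷_; _++_; length)
import Data.List.NonEmpty.Base as List⁺
import Data.List.Properties as Listₚ
open import Data.List.Relation.Unary.All using (All; []; _∷_)
open import Data.List.Relation.Unary.All.Properties using (all-filter)
open import Data.Nat.Base as ℕ using (ℕ; zero; suc; _≤_; _<_; _∸_; _^_; _*_; s≤s; z≤n)
open import Data.Nat.Properties as ℕₚ using (m^n≢0)
open import Data.Product.Base using (∃-syntax; ∃; ∃₂; _×_; _,_; proj₁; proj₂; uncurry)
open import Data.Rational.Base as ℚ using (ℚ; 0ℚ; _/_)
import Data.Rational.Properties as ℚₚ
import Data.Rational.Unnormalised.Base as ℚᵘ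
import Data.Rational.Unnormalised.Properties as ℚᵘₚ
open import Data.Sum.Base as Sum using (_⊎_; inj₁; inj₂)
open import Data.Vec.Base as Vec using (Vec; []; _∷_)
open import Data.Vec.Functional using (foldr; insertAt; removeAt)
open import Data.Vec.Functional.Properties using (insertAt-lookup; insertAt-punchIn)
import Data.Vec.Properties as Vecₚ
open import Data.Vec.Relation.Binary.Pointwise.Inductive using (Pointwise; []; _∷_)
open import Function.Base using (_∘_)
open import Level using (_⊔_)
open import Relation.Binary.PropositionalEquality as ≡ using (_≡_; _≢_; cong; cong₂)
open import Relation.Nullary.Decidable using (Dec; yes; no; does; map′; _×-dec_)
open import Relation.Nullary.Negation using (¬_; contradiction)

-- Cutting the layers into an initial and a final segment would only give rank at most n, because
-- the two sides share a single vertex. With alternating layers the two sides have to agree at every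
-- interior vertex, which is what makes the rank n^(d-1). Rank itself is never defined: the rows are
-- shown independent and are placed in the span of an explicit list, whose length is the bound. The
-- factor 2 per linear form comes from an asymmetry between its two parts. The part on the odd
-- layers only turns rows into combinations of other rows, so it keeps the generators; the part on
-- the even layers acts on all rows by one linear map, so it contributes the images of the
-- generators. Polynomial equality compares coefficients, whereas degree and support have to be read
-- off terms. Hence polynomials act by convolution on arbitrary coefficient functions, and forms are
-- first replaced by lists whose terms all have degree one.

-- Exponent vectors, and mixing two of them along a mask.

infixl 6 _⊕_
_⊕_ : ∀ {N} → Monomial N → Monomial N → Monomial N
_⊕_ = Vec.zipWith ℕ._+_

⊕-comm : ∀ {N} (e k : Monomial N) → e ⊕ k ≡ k ⊕ e
⊕-comm = Vecₚ.zipWith-comm ℕₚ.+-comm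

⊕-cancelˡ : ∀ {N} (e : Monomial N) {k k′} → e ⊕ k ≡ e ⊕ k′ → k ≡ k′
⊕-cancelˡ []      {[]}    {[]}      _  = ≡.refl
⊕-cancelˡ (a ∷ e) {b ∷ k} {b′ ∷ k′} eq =
  cong₂ _∷_ (ℕₚ.+-cancelˡ-≡ a b b′ (Vecₚ.∷-injectiveˡ eq)) (⊕-cancelˡ e (Vecₚ.∷-injectiveʳ eq))

sum-⊕ : ∀ {N} (e k : Monomial N) → Vec.sum (e ⊕ k) ≡ Vec.sum e ℕ.+ Vec.sum k
sum-⊕ []      []      = ≡.refl
sum-⊕ (a ∷ e) (b ∷ k) = ≡.trans (cong (a ℕ.+ b ℕ.+_) (sum-⊕ e k)) (interchange a b (Vec.sum e) (Vec.sum k))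
  where open import Algebra.Properties.CommutativeSemigroup ℕₚ.+-commutativeSemigroup using (interchange)

divide? : ∀ {N} (e m : Monomial N) → Dec (∃ λ k → m ≡ e ⊕ k)
divide? []      []      = yes ([] , ≡.refl)
divide? (a ∷ e) (b ∷ m) = map′
  (λ (a≤b , k , m≡e⊕k) → b ∸ a ∷ k , cong₂ _∷_ (≡.sym (ℕₚ.m+[n∸m]≡n a≤b)) m≡e⊕k)
  (λ { (c ∷ k , eq) → ≡.subst (a ≤_) (≡.sym (Vecₚ.∷-injectiveˡ eq)) (ℕₚ.m≤m+n a c)
                    , k , Vecₚ.∷-injectiveʳ eq })
  ((a ℕₚ.≤? b) ×-dec divide? e m)

-- The monomial at position (`x`, `y`) of the coefficient matrix: on the mask the row index decides,
-- off it the column index.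
mix : ∀ {N} → Vec Bool N → Monomial N → Monomial N → Monomial N
mix []      []      []      = []
mix (b ∷ M) (a ∷ x) (c ∷ y) = (if b then a else c) ∷ mix M x y

SupportedOn : ∀ {N} → Vec Bool N → Monomial N → Set
SupportedOn = Pointwise (λ b a → b ≡ false → a ≡ 0)

mix-swap : ∀ {N} (M : Vec Bool N) x y → mix (Vec.map not M) x y ≡ mix M y x
mix-swap []          []      []      = ≡.refl
mix-swap (true  ∷ M) (_ ∷ x) (_ ∷ y) = cong (_ ∷_) (mix-swap M x y)
mix-swap (false ∷ M) (_ ∷ x) (_ ∷ y) = cong (_ ∷_) (mix-swap M x y)

mix-idem : ∀ {N} (M : Vec Bool N) x → mix M x x ≡ x
mix-idem []          []      = ≡.refl
mix-idem (true  ∷ M) (_ ∷ x) = cong (_ ∷_) (mix-idem M x)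
mix-idem (false ∷ M) (_ ∷ x) = cong (_ ∷_) (mix-idem M x)

mix-absorbˡ : ∀ {N} (M : Vec Bool N) x y z → mix M (mix M x y) z ≡ mix M x z
mix-absorbˡ []          []      []      []      = ≡.refl
mix-absorbˡ (true  ∷ M) (_ ∷ x) (_ ∷ y) (_ ∷ z) = cong (_ ∷_) (mix-absorbˡ M x y z)
mix-absorbˡ (false ∷ M) (_ ∷ x) (_ ∷ y) (_ ∷ z) = cong (_ ∷_) (mix-absorbˡ M x y z)

⊕-mixˡ : ∀ {N} {M : Vec Bool N} {e} → SupportedOn M e → ∀ k y → e ⊕ mix M k y ≡ mix M (e ⊕ k) y
⊕-mixˡ []                             []      []      = ≡.refl
⊕-mixˡ {M = true  ∷ _} (_    ∷ supp) (_ ∷ k) (_ ∷ y) = cong (_ ∷_) (⊕-mixˡ supp k y)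
⊕-mixˡ {M = false ∷ _} (zero? ∷ supp) (_ ∷ k) (c ∷ y) =
  cong₂ _∷_ (cong (ℕ._+ c) (zero? ≡.refl)) (⊕-mixˡ supp k y)

-- On the mask `x` agrees with the mixture, so its quotient there is `k`; off the mask `e` vanishes,
-- so the quotient is `x` itself. This gives the witness `mix M k x`.
mix-divides : ∀ {N} {M : Vec Bool N} {e} → SupportedOn M e → ∀ {x y k} →
              mix M x y ≡ e ⊕ k → x ≡ e ⊕ mix M k x
mix-divides {M = M} {e} supp {x} {y} {k} mix≡ = begin
  x                     ≡⟨ mix-idem M x ⟨
  mix M x x             ≡⟨ mix-absorbˡ M x y x ⟨
  mix M (mix M x y) x   ≡⟨ cong (λ z → mix M z x) mix≡ ⟩
  mix M (e ⊕ k) x       ≡⟨ ⊕-mixˡ supp k x ⟨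
  e ⊕ mix M k x         ∎
  where open ≡.≡-Reasoning

degree0-supported : ∀ {N} (M : Vec Bool N) e → Vec.sum e ≡ 0 → SupportedOn M e
degree0-supported []      []      _  = []
degree0-supported (_ ∷ M) (a ∷ e) eq =
  (λ _ → ℕₚ.m+n≡0⇒m≡0 a eq) ∷ degree0-supported M e (ℕₚ.m+n≡0⇒n≡0 a eq)

-- A monomial of degree one is a single variable, and that variable is either on the mask or off it.
degree1-supported : ∀ {N} (M : Vec Bool N) e → Vec.sum e ≡ 1 →
                    SupportedOn M e ⊎ SupportedOn (Vec.map not M) e
degree1-supported (b     ∷ M) (zero  ∷ e) eq =
  Sum.map ((λ _ → ≡.refl) ∷_) ((λ _ → ≡.refl) ∷_) (degree1-supported M e eq)
degree1-supported (true  ∷ M) (suc a ∷ e) eq =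
  inj₁ ((λ ()) ∷ degree0-supported M e (ℕₚ.m+n≡0⇒n≡0 a (ℕₚ.suc-injective eq)))
degree1-supported (false ∷ M) (suc a ∷ e) eq =
  inj₂ ((λ ()) ∷ degree0-supported _ e (ℕₚ.m+n≡0⇒n≡0 a (ℕₚ.suc-injective eq)))

𝟎 : ∀ {N} → Monomial N
𝟎 = Vec.replicate _ 0

sum-𝟎 : ∀ N → Vec.sum (𝟎 {N}) ≡ 0
sum-𝟎 zero    = ≡.refl
sum-𝟎 (suc N) = sum-𝟎 N

unit : ∀ {N} → Fin N → Monomial N
unit v = Vec.tabulate (λ w → if does (v Fin.≟ w) then 1 else 0)

𝟎-++ : ∀ k {N} → 𝟎 {k ℕ.+ N} ≡ 𝟎 {k} Vec.++ 𝟎 {N}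
𝟎-++ zero    = ≡.refl
𝟎-++ (suc k) = cong (0 ∷_) (𝟎-++ k)

tabulate-0 : ∀ N → Vec.tabulate {n = N} (λ _ → 0) ≡ 𝟎
tabulate-0 zero    = ≡.refl
tabulate-0 (suc N) = cong (0 ∷_) (tabulate-0 N)

sum-unit : ∀ {N} (v : Fin N) → Vec.sum (unit v) ≡ 1
sum-unit {suc N} zero    = cong suc (≡.trans (cong Vec.sum (tabulate-0 N)) (sum-𝟎 N))
sum-unit         (suc v) = sum-unit v

unit-injective : ∀ {N} {v w : Fin N} → unit v ≡ unit w → v ≡ w
unit-injective {v = zero}  {zero}  _  = ≡.refl
unit-injective {v = suc v} {suc w} eq = cong suc (unit-injective (Vecₚ.∷-injectiveʳ eq))

unit-↑ˡ : ∀ {k} (v : Fin k) N → unit (v ↑ˡ N) ≡ unit v Vec.++ 𝟎 {N}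
unit-↑ˡ {suc k} zero    N = cong (1 ∷_)
  (≡.trans (tabulate-0 (k ℕ.+ N)) (≡.trans (𝟎-++ k) (cong (Vec._++ 𝟎) (≡.sym (tabulate-0 k)))))
unit-↑ˡ         (suc v) N = cong (0 ∷_) (unit-↑ˡ v N)

unit-↑ʳ : ∀ k {N} (v : Fin N) → unit (k ↑ʳ v) ≡ 𝟎 {k} Vec.++ unit v
unit-↑ʳ zero    v = ≡.refl
unit-↑ʳ (suc k) v = cong (0 ∷_) (unit-↑ʳ k v)

-- Walks as monomials, and the mask of odd layers.

module _ (n : ℕ) where

  -- The argument `d` counts interior vertices, so there are `suc d` edges, each a single variable
  -- in its own block of `n * n` exponents.
  walk : ∀ d → Fin n → Fin n → Vec (Fin n) d → Monomial (suc d * (n * n))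
  walk zero    a b []      = unit (combine a b) Vec.++ []
  walk (suc d) a b (k ∷ w) = unit (combine a k) Vec.++ walk d k b w

  -- Layers are numbered from 1, as in A¹,…,Aᵈ.
  oddLayers : ∀ d → Vec Bool (d * (n * n))
  oddLayers zero    = []
  oddLayers (suc d) = Vec.replicate (n * n) true Vec.++ Vec.map not (oddLayers d)

  -- The mask of the remaining layers is complemented, and complementing a mask amounts to
  -- exchanging the two monomials. All inductions on mixed walks therefore swap the walks at each
  -- step.
  mix-oddLayers : ∀ d (u v : Monomial (n * n)) x y →
    mix (oddLayers (suc d)) (u Vec.++ x) (v Vec.++ y) ≡ u Vec.++ mix (oddLayers d) y x
  mix-oddLayers d u v x y = ≡.trans (mix-trues u v) (cong (u Vec.++_) (mix-swap (oddLayers d) x y))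
    where
    mix-trues : ∀ {k N} {M : Vec Bool N} (u v : Monomial k) {x y} →
                mix (Vec.replicate k true Vec.++ M) (u Vec.++ x) (v Vec.++ y) ≡ u Vec.++ mix M x y
    mix-trues []      []      = ≡.refl
    mix-trues (a ∷ u) (_ ∷ v) = cong (a ∷_) (mix-trues u v)

  -- Each layer carries exactly one edge, whichever walk supplies it. Two start vertices are allowed
  -- since the tails begin at `k` and `k′`.
  sum-mix-walk : ∀ d a a′ b w w′ → Vec.sum (mix (oddLayers (suc d)) (walk d a b w) (walk d a′ b w′)) ≡ suc d
  sum-mix-walk zero a a′ b [] [] = ≡.trans
    (cong Vec.sum (mix-oddLayers 0 (unit (combine a b)) (unit (combine a′ b)) [] []))
    (≡.trans (Vecₚ.sum-++ (unit (combine a b))) (cong (ℕ._+ 0) (sum-unit (combine a b))))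
  sum-mix-walk (suc d) a a′ b (k ∷ w) (k′ ∷ w′) = ≡.trans
    (cong Vec.sum (mix-oddLayers (suc d) (unit (combine a k)) (unit (combine a′ k′)) (walk d k b w) (walk d k′ b w′)))
    (≡.trans (Vecₚ.sum-++ (unit (combine a k))) (cong₂ ℕ._+_ (sum-unit (combine a k)) (sum-mix-walk d k′ k b w′ w)))

  vertices : ∀ d → Fin (n ^ d) → Vec (Fin n) d
  vertices zero    i = []
  vertices (suc d) i = let k , j = remQuot (n ^ d) i in k ∷ vertices d j

  vertices-injective : ∀ d {i j} → vertices d i ≡ vertices d j → i ≡ j
  vertices-injective zero    {zero} {zero} _ = ≡.refl
  vertices-injective (suc d) {i}    {j}    eq = begin
    i                                        ≡⟨ Fin.combine-remQuot {n} (n ^ d) i ⟨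
    uncurry combine (remQuot {n} (n ^ d) i)  ≡⟨ cong₂ combine (Vecₚ.∷-injectiveˡ eq) (vertices-injective d (Vecₚ.∷-injectiveʳ eq)) ⟩
    uncurry combine (remQuot {n} (n ^ d) j)  ≡⟨ Fin.combine-remQuot {n} (n ^ d) j ⟩
    j                                        ∎
    where open ≡.≡-Reasoning

module _ {c ℓ₁ ℓ₂} (F : HeytingField c ℓ₁ ℓ₂) where

  open HeytingField F using (heytingCommutativeRing; _#_; tight; #-irrefl; #⇒invertible)
  private
    R : CommutativeRing c ℓ₁
    R = HeytingCommutativeRing.commutativeRing heytingCommutativeRing
  open CommutativeRing R hiding (zero) renaming (_+_ to _+F_; _*_ to _*F_)
  open import Algebra.Properties.Semiring.Sum semiring
  open import Algebra.Apartness.Properties.HeytingCommutativeRing heytingCommutativeRing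
    using (1#0; x-0≈x)
  open import Algebra.Properties.Ring ring using (-‿distribˡ-*)
  open import Algebra.Properties.CommutativeSemigroup
    *-commutativeSemigroup using () renaming (x∙yz≈y∙xz to *-swap)
  open import Algebra.Properties.CommutativeSemigroup
    +-commutativeSemigroup using ()
    renaming (interchange to +-interchange; x∙yz≈y∙xz to +-swap)
  open import Relation.Binary.Reasoning.Setoid setoid

  -- Multiplication as convolution on coefficient functions.

  -- On coefficient functions, multiplication by the monomial e.
  shift : ∀ {N} → Monomial N → (Monomial N → Carrier) → Monomial N → Carrier
  shift e g m with divide? e m
  ... | yes (k , _) = g k
  ... | no  _       = 0#

  shift-⊕ : ∀ {N} e (g : Monomial N → Carrier) k → shift e g (e ⊕ k) ≡ g k
  shift-⊕ e g k with divide? e (e ⊕ k)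
  ... | yes (k′ , eq) = cong g (⊕-cancelˡ e (≡.sym eq))
  ... | no  e∤        = contradiction (k , ≡.refl) e∤

  shift-vanish : ∀ {N} e (g : Monomial N → Carrier) {m} →
                 (∀ k → m ≡ e ⊕ k → g k ≈ 0#) → shift e g m ≈ 0#
  shift-vanish e g {m} g≈0 with divide? e m
  ... | yes (k , eq) = g≈0 k eq
  ... | no  _        = refl

  shift-cong : ∀ {N} e {g h : Monomial N → Carrier} → (∀ m → g m ≈ h m) →
               ∀ m → shift e g m ≈ shift e h m
  shift-cong e g≈h m with divide? e m
  ... | yes (k , _) = g≈h k
  ... | no  _       = refl

  shift-linear : ∀ {N} e a (g h : Monomial N → Carrier) m →
                 shift e (λ m′ → a *F g m′ +F h m′) m ≈ a *F shift e g m +F shift e h m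
  shift-linear e a g h m with divide? e m
  ... | yes _ = refl
  ... | no  _ = sym (trans (+-identityʳ _) (zeroʳ a))

  -- A monomial on the mask leaves the column index alone: whether it divides the mixture, and with
  -- what quotient, depends on `x` only.
  shift-mixˡ : ∀ {N} {M : Vec Bool N} {e} → SupportedOn M e → ∀ g x y →
               shift e g (mix M x y) ≈ shift e (λ x′ → g (mix M x′ y)) x
  shift-mixˡ {M = M} {e} supp g x y with divide? e x
  ... | yes (k , ≡.refl) = reflexive (≡.trans (cong (shift e g) (≡.sym (⊕-mixˡ supp k y)))
                                              (shift-⊕ e g (mix M k y)))
  ... | no  e∤x = shift-vanish e g λ k mix≡ → contradiction
    (mix M k x , mix-divides supp mix≡) e∤x

  shift-mixʳ : ∀ {N} {M : Vec Bool N} {e} → SupportedOn (Vec.map not M) e → ∀ g x y →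
               shift e g (mix M x y) ≈ shift e (λ y′ → g (mix M x y′)) y
  shift-mixʳ {M = M} {e} supp g x y = begin
    shift e g (mix M x y)                               ≡⟨ cong (shift e g) (mix-swap M y x) ⟨
    shift e g (mix (Vec.map not M) y x)                 ≈⟨ shift-mixˡ supp g y x ⟩
    shift e (λ y′ → g (mix (Vec.map not M) y′ x)) y     ≈⟨ shift-cong e (λ y′ → reflexive (cong g (mix-swap M y′ x))) y ⟩
    shift e (λ y′ → g (mix M x y′)) y                   ∎

  δ : ∀ {N} → Monomial N → Monomial N → Carrier
  δ e m = if does (Vecₚ.≡-dec ℕₚ._≟_ e m) then 1# else 0#

  δ-diag : ∀ {N} {e m : Monomial N} → e ≡ m → δ e m ≈ 1#
  δ-diag {e = e} {m} e≡m with Vecₚ.≡-dec ℕₚ._≟_ e m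
  ... | yes _   = refl
  ... | no  e≢m = contradiction e≡m e≢m

  δ-off : ∀ {N} (e m : Monomial N) → e ≢ m → δ e m ≈ 0#
  δ-off e m e≢m with Vecₚ.≡-dec ℕₚ._≟_ e m
  ... | yes e≡m = contradiction e≡m e≢m
  ... | no  _   = refl

  shift-δ : ∀ {N} (e e′ : Monomial N) m → shift e (δ e′) m ≈ δ (e ⊕ e′) m
  shift-δ e e′ m with Vecₚ.≡-dec ℕₚ._≟_ (e ⊕ e′) m
  ... | yes ≡.refl = trans (reflexive (shift-⊕ e (δ e′) e′)) (δ-diag {e = e′} ≡.refl)
  ... | no  ee′≢m  = shift-vanish e (δ e′) λ k m≡ →
    δ-off e′ k λ e′≡k → ee′≢m (≡.trans (cong (e ⊕_) e′≡k) (≡.sym m≡))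

  coeff-∷ : ∀ {N} a (e : Monomial N) p m → coeff F ((a , e) ∷ p) m ≈ a *F δ e m +F coeff F p m
  coeff-∷ a e p m with Vecₚ.≡-dec ℕₚ._≟_ e m
  ... | yes _ = +-congʳ (sym (*-identityʳ a))
  ... | no  _ = sym (trans (+-congʳ (zeroʳ a)) (+-identityˡ _))

  coeff-++ : ∀ {N} (p q : Poly F N) m → coeff F (p ++ q) m ≈ coeff F p m +F coeff F q m
  coeff-++ []            q m = sym (+-identityˡ _)
  coeff-++ ((a , e) ∷ p) q m = begin
    coeff F ((a , e) ∷ p ++ q) m                 ≈⟨ coeff-∷ a e (p ++ q) m ⟩
    a *F δ e m +F coeff F (p ++ q) m             ≈⟨ +-congˡ (coeff-++ p q m) ⟩
    a *F δ e m +F (coeff F p m +F coeff F q m)   ≈⟨ +-assoc _ _ _ ⟨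
    a *F δ e m +F coeff F p m +F coeff F q m     ≈⟨ +-congʳ (coeff-∷ a e p m) ⟨
    coeff F ((a , e) ∷ p) m +F coeff F q m       ∎

  infixr 7 _⋆_
  -- The right argument is any function on monomials, not only the coefficients of a polynomial,
  -- because the generators of row spans are bare functions.
  _⋆_ : ∀ {N} → Poly F N → (Monomial N → Carrier) → Monomial N → Carrier
  ([]            ⋆ g) m = 0#
  (((a , e) ∷ p) ⋆ g) m = a *F shift e g m +F (p ⋆ g) m

  ⋆-cong : ∀ {N} (p : Poly F N) {g h} → (∀ m → g m ≈ h m) → ∀ m → (p ⋆ g) m ≈ (p ⋆ h) m
  ⋆-cong []            g≈h m = refl
  ⋆-cong ((a , e) ∷ p) g≈h m = +-cong (*-congˡ (shift-cong e g≈h m)) (⋆-cong p g≈h m)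

  ⋆-zero : ∀ {N} (p : Poly F N) {g} → (∀ m → g m ≈ 0#) → ∀ m → (p ⋆ g) m ≈ 0#
  ⋆-zero []            g≈0 m = refl
  ⋆-zero ((a , e) ∷ p) g≈0 m = begin
    a *F shift e _ m +F (p ⋆ _) m ≈⟨ +-cong (*-congˡ (shift-vanish e _ (λ k _ → g≈0 k))) (⋆-zero p g≈0 m) ⟩
    a *F 0# +F 0#                 ≈⟨ +-identityʳ _ ⟩
    a *F 0#                       ≈⟨ zeroʳ a ⟩
    0#                            ∎

  linear-+ : ∀ a b x y x′ y′ → b *F (a *F x +F y) +F (a *F x′ +F y′) ≈
             a *F (b *F x +F x′) +F (b *F y +F y′)
  linear-+ a b x y x′ y′ = begin
    b *F (a *F x +F y) +F (a *F x′ +F y′)           ≈⟨ +-congʳ (distribˡ b _ _) ⟩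
    b *F (a *F x) +F b *F y +F (a *F x′ +F y′)      ≈⟨ +-interchange _ _ _ _ ⟩
    b *F (a *F x) +F a *F x′ +F (b *F y +F y′)      ≈⟨ +-congʳ (+-congʳ (*-swap b a x)) ⟩
    a *F (b *F x) +F a *F x′ +F (b *F y +F y′)      ≈⟨ +-congʳ (distribˡ a _ _) ⟨
    a *F (b *F x +F x′) +F (b *F y +F y′)           ∎

  ⋆-linear : ∀ {N} (p : Poly F N) a g h m →
             (p ⋆ (λ m′ → a *F g m′ +F h m′)) m ≈ a *F (p ⋆ g) m +F (p ⋆ h) m
  ⋆-linear []            a g h m = sym (trans (+-identityʳ _) (zeroʳ a))
  ⋆-linear ((b , e) ∷ p) a g h m = begin
    b *F shift e (λ m′ → a *F g m′ +F h m′) m +F (p ⋆ (λ m′ → a *F g m′ +F h m′)) m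
      ≈⟨ +-cong (*-congˡ (shift-linear e a g h m)) (⋆-linear p a g h m) ⟩
    b *F (a *F shift e g m +F shift e h m) +F (a *F (p ⋆ g) m +F (p ⋆ h) m)
      ≈⟨ linear-+ a b _ _ _ _ ⟩
    a *F (b *F shift e g m +F (p ⋆ g) m) +F (b *F shift e h m +F (p ⋆ h) m) ∎

  termTimes : ∀ {N} → Carrier → Monomial N → Poly F N → Poly F N
  termTimes a e = List.map λ (b , e′) → a *F b , e ⊕ e′

  coeff-term-* : ∀ {N} a (e : Monomial N) q m → coeff F (termTimes a e q) m ≈ a *F shift e (coeff F q) m
  coeff-term-* a e []             m =
    sym (trans (*-congˡ (shift-vanish e _ (λ _ _ → refl))) (zeroʳ a))
  coeff-term-* a e ((b , e′) ∷ q) m = begin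
    coeff F (termTimes a e ((b , e′) ∷ q)) m
      ≈⟨ coeff-∷ (a *F b) (e ⊕ e′) (termTimes a e q) m ⟩
    a *F b *F δ (e ⊕ e′) m +F coeff F (termTimes a e q) m
      ≈⟨ +-cong (trans (*-assoc a b _) (*-congˡ (*-congˡ (sym (shift-δ e e′ m))))) (coeff-term-* a e q m) ⟩
    a *F (b *F shift e (δ e′) m) +F a *F shift e (coeff F q) m
      ≈⟨ distribˡ a _ _ ⟨
    a *F (b *F shift e (δ e′) m +F shift e (coeff F q) m)
      ≈⟨ *-congˡ (shift-linear e b (δ e′) (coeff F q) m) ⟨
    a *F shift e (λ m′ → b *F δ e′ m′ +F coeff F q m′) m
      ≈⟨ *-congˡ (shift-cong e (coeff-∷ b e′ q) m) ⟨
    a *F shift e (coeff F ((b , e′) ∷ q)) m ∎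

  coeff-* : ∀ {N} (p q : Poly F N) m → coeff F (_*ₚ_ F p q) m ≈ (p ⋆ coeff F q) m
  coeff-* []            q m = refl
  coeff-* ((a , e) ∷ p) q m =
    trans (coeff-++ (termTimes a e q) (_*ₚ_ F p q) m) (+-cong (coeff-term-* a e q m) (coeff-* p q m))

  shift-coeff : ∀ {N} e (q : Poly F N) m → shift e (coeff F q) m ≈ (q ⋆ δ e) m
  shift-coeff e []             m = shift-vanish e _ (λ _ _ → refl)
  shift-coeff e ((b , e′) ∷ q) m = begin
    shift e (coeff F ((b , e′) ∷ q)) m                     ≈⟨ shift-cong e (coeff-∷ b e′ q) m ⟩
    shift e (λ m′ → b *F δ e′ m′ +F coeff F q m′) m        ≈⟨ shift-linear e b _ _ m ⟩
    b *F shift e (δ e′) m +F shift e (coeff F q) m         ≈⟨ +-cong (*-congˡ δ-comm) (shift-coeff e q m) ⟩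
    b *F shift e′ (δ e) m +F (q ⋆ δ e) m                   ∎
    where
    δ-comm : shift e (δ e′) m ≈ shift e′ (δ e) m
    δ-comm = begin
      shift e (δ e′) m   ≈⟨ shift-δ e e′ m ⟩
      δ (e ⊕ e′) m       ≡⟨ cong (λ k → δ k m) (⊕-comm e e′) ⟩
      δ (e′ ⊕ e) m       ≈⟨ shift-δ e′ e m ⟨
      shift e′ (δ e) m   ∎

  coeff-*-comm : ∀ {N} (p q : Poly F N) m → coeff F (_*ₚ_ F p q) m ≈ (q ⋆ coeff F p) m
  coeff-*-comm p q m = trans (coeff-* p q m) (⋆-comm p m)
    where
    ⋆-comm : ∀ p m → (p ⋆ coeff F q) m ≈ (q ⋆ coeff F p) m
    ⋆-comm []            m = sym (⋆-zero q (λ _ → refl) m)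
    ⋆-comm ((a , e) ∷ p) m = begin
      a *F shift e (coeff F q) m +F (p ⋆ coeff F q) m     ≈⟨ +-cong (*-congˡ (shift-coeff e q m)) (⋆-comm p m) ⟩
      a *F (q ⋆ δ e) m +F (q ⋆ coeff F p) m               ≈⟨ ⋆-linear q a _ _ m ⟨
      (q ⋆ (λ m′ → a *F δ e m′ +F coeff F p m′)) m        ≈⟨ ⋆-cong q (coeff-∷ a e p) m ⟨
      (q ⋆ coeff F ((a , e) ∷ p)) m                       ∎

  -- `_⋆_` recurses on the terms of its left factor but sees the right one only through
  -- coefficients, so the factors are commuted first. This permits replacing a form by a better list
  -- of terms.
  *ₚ-congˡ : ∀ {N} (p p′ : Poly F N) → _≈ₚ_ F p p′ → ∀ q → _≈ₚ_ F (_*ₚ_ F p q) (_*ₚ_ F p′ q)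
  *ₚ-congˡ p p′ p≈p′ q m =
    trans (coeff-*-comm p q m) (trans (⋆-cong q p≈p′ m) (sym (coeff-*-comm p′ q m)))

  -- Spans, independence and the dimension bound.

  -- Stands in for rank: a matrix whose rows all lie in `Span L` has rank at most `length L`.
  -- Peeling off one generator at a time is the form that elimination consumes.
  Span : ∀ {Y : Set} → List (Y → Carrier) → (Y → Carrier) → Set (c ⊔ ℓ₁)
  Span []      v = Level.Lift c (∀ y → v y ≈ 0#)
  Span (g ∷ L) v = ∃₂ λ a w → Span L w × (∀ y → v y ≈ a *F g y +F w y)

  module _ {Y : Set} where

    span-cong : ∀ L {v w : Y → Carrier} → (∀ y → v y ≈ w y) → Span L w → Span L v
    span-cong []      v≈w (Level.lift w≈0)       = Level.lift λ y → trans (v≈w y) (w≈0 y)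
    span-cong (g ∷ L) v≈w (a , w′ , w′∈L , w≈)   = a , w′ , w′∈L , λ y → trans (v≈w y) (w≈ y)

    span-zero : ∀ L {v : Y → Carrier} → (∀ y → v y ≈ 0#) → Span L v
    span-zero []      v≈0 = Level.lift v≈0
    span-zero (g ∷ L) v≈0 = 0# , (λ _ → 0#) , span-zero L (λ _ → refl) , λ y →
      trans (v≈0 y) (sym (trans (+-identityʳ _) (zeroˡ (g y))))

    span-linear : ∀ L b {v w : Y → Carrier} → Span L v → Span L w → Span L (λ y → b *F v y +F w y)
    span-linear []      b (Level.lift v≈0) (Level.lift w≈0) =
      Level.lift λ y → trans (+-cong (trans (*-congˡ (v≈0 y)) (zeroʳ b)) (w≈0 y)) (+-identityʳ 0#)
    span-linear (g ∷ L) b (a , v′ , v′∈L , v≈) (a′ , w′ , w′∈L , w≈) =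
      b *F a +F a′ , _ , span-linear L b v′∈L w′∈L , λ y → trans
        (+-cong (*-congˡ (v≈ y)) (w≈ y))
        (begin
          b *F (a *F g y +F v′ y) +F (a′ *F g y +F w′ y)        ≈⟨ +-congʳ (distribˡ b _ _) ⟩
          b *F (a *F g y) +F b *F v′ y +F (a′ *F g y +F w′ y)   ≈⟨ +-interchange _ _ _ _ ⟩
          b *F (a *F g y) +F a′ *F g y +F (b *F v′ y +F w′ y)   ≈⟨ +-congʳ (+-congʳ (*-assoc b a _)) ⟨
          b *F a *F g y +F a′ *F g y +F (b *F v′ y +F w′ y)     ≈⟨ +-congʳ (distribʳ (g y) _ _) ⟨
          (b *F a +F a′) *F g y +F (b *F v′ y +F w′ y)          ∎)

    span-+ : ∀ L {v w : Y → Carrier} → Span L v → Span L w → Span L (λ y → v y +F w y)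
    span-+ L v∈L w∈L = span-cong L (λ y → +-congʳ (sym (*-identityˡ _))) (span-linear L 1# v∈L w∈L)

    span-++ : ∀ L {L′} {v w : Y → Carrier} → Span L v → Span L′ w → Span (L ++ L′) (λ y → v y +F w y)
    span-++ []      {L′} (Level.lift v≈0)      w∈L′ =
      span-cong L′ (λ y → trans (+-congʳ (v≈0 y)) (+-identityˡ _)) w∈L′
    span-++ (g ∷ L)      (a , v′ , v′∈L , v≈) w∈L′ =
      a , _ , span-++ L v′∈L w∈L′ , λ y → trans (+-congʳ (v≈ y)) (+-assoc _ _ _)

    span-concat : ∀ {k} (Ls : Fin k → List (Y → Carrier)) i {v} →
                  Span (Ls i) v → Span (List.concat (List.tabulate Ls)) v
    span-concat Ls zero    v∈ = span-cong (Ls zero ++ _) (λ y → sym (+-identityʳ _))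
      (span-++ (Ls zero) v∈ (span-zero (List.concat (List.tabulate (Ls ∘ suc))) (λ _ → refl)))
    span-concat Ls (suc i) v∈ = span-cong (Ls zero ++ _) (λ y → sym (+-identityˡ _))
      (span-++ (Ls zero) (span-zero (Ls zero) (λ _ → refl)) (span-concat (Ls ∘ suc) i v∈))

    -- The hypotheses are pointwise equations, so that compatibility with pointwise equality is part
    -- of linearity.
    record IsLinearMap {Z : Set} (φ : (Y → Carrier) → Z → Carrier) : Set (c ⊔ ℓ₁) where
      field
        φ-zero   : ∀ {v} → (∀ y → v y ≈ 0#) → ∀ z → φ v z ≈ 0#
        φ-linear : ∀ {v} a g w → (∀ y → v y ≈ a *F g y +F w y) → ∀ z → φ v z ≈ a *F φ g z +F φ w z

    span-map : ∀ {Z : Set} {φ : (Y → Carrier) → Z → Carrier} → IsLinearMap φ →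
               ∀ L {v} → Span L v → Span (List.map φ L) (φ v)
    span-map lin []      (Level.lift v≈0)     = Level.lift (IsLinearMap.φ-zero lin v≈0)
    span-map lin (g ∷ L) (a , w , w∈L , v≈)   =
      a , _ , span-map lin L w∈L , IsLinearMap.φ-linear lin a g w v≈

    Independent : ∀ {r} → (Fin r → Y → Carrier) → Set (c ⊔ ℓ₁)
    Independent {r} v = (x : Fin r → Carrier) → (∀ y → sum (λ i → x i *F v i y) ≈ 0#) → ∀ i → x i ≈ 0#

    -- Gaussian elimination.  The goal is a negation, so by tightness of the
    -- apartness the absence of a pivot yields a zero column.
    ¬independent : ∀ {r} L → length L < r → (v : Fin r → Y → Carrier) →
                   (∀ i → Span L (v i)) → ¬ Independent v
    ¬independent {suc r} []      _         v v∈ indep =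
      #-irrefl (indep (λ _ → 1#) sum≈0 zero) 1#0
      where
      sum≈0 : ∀ y → sum (λ i → 1# *F v i y) ≈ 0#
      sum≈0 y = trans (sum-cong-≋ λ i → trans (*-identityˡ _) (Level.lower (v∈ i) y))
                      (sum-replicate-zero (suc r))
    ¬independent {suc r} (g ∷ L) (s≤s L<r) v v∈ indep =
      ¬independent L (ℕₚ.m≤n⇒m≤1+n L<r) v (λ i → span-cong L (v≈w i) (w∈L i)) indep
      where
      a : Fin (suc r) → Carrier
      a i = proj₁ (v∈ i)

      w : Fin (suc r) → Y → Carrier
      w i = proj₁ (proj₂ (v∈ i))

      w∈L : ∀ i → Span L (w i)
      w∈L i = proj₁ (proj₂ (proj₂ (v∈ i)))

      v≈ : ∀ i y → v i y ≈ a i *F g y +F w i y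
      v≈ i = proj₂ (proj₂ (proj₂ (v∈ i)))

      ¬pivot : ∀ p → ¬ (a p # 0#)
      ¬pivot p ap#0 = ¬independent L L<r v′ v′∈L indep′
        where
        a⁻¹ : Carrier
        a⁻¹ = proj₁ (#⇒invertible ap#0)

        a⁻¹a≈1 : a⁻¹ *F a p ≈ 1#
        a⁻¹a≈1 = trans (*-congˡ (sym (x-0≈x (a p)))) (proj₁ (proj₂ (#⇒invertible ap#0)))

        -- The row operation that clears `g`: adding `t i` times the pivot vector cancels its
        -- coefficient.
        t : Fin r → Carrier
        t i = - (a (punchIn p i) *F a⁻¹)

        ta≈-a : ∀ i → t i *F a p +F a (punchIn p i) ≈ 0#
        ta≈-a i = begin
          t i *F a p +F b                 ≈⟨ +-congʳ (-‿distribˡ-* (b *F a⁻¹) (a p)) ⟨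
          - (b *F a⁻¹ *F a p) +F b        ≈⟨ +-congʳ (-‿cong (*-assoc b a⁻¹ (a p))) ⟩
          - (b *F (a⁻¹ *F a p)) +F b      ≈⟨ +-congʳ (-‿cong (*-congˡ a⁻¹a≈1)) ⟩
          - (b *F 1#) +F b                ≈⟨ +-congʳ (-‿cong (*-identityʳ b)) ⟩
          - b +F b                        ≈⟨ -‿inverseˡ b ⟩
          0#                              ∎
          where b = a (punchIn p i)

        v′ : Fin r → Y → Carrier
        v′ i y = t i *F v p y +F v (punchIn p i) y

        v′∈L : ∀ i → Span L (v′ i)
        v′∈L i = span-cong L v′≈ (span-linear L (t i) (w∈L p) (w∈L (punchIn p i)))
          where
          v′≈ : ∀ y → v′ i y ≈ t i *F w p y +F w (punchIn p i) y
          v′≈ y = begin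
            t i *F v p y +F v (punchIn p i) y
              ≈⟨ +-cong (trans (*-congˡ (v≈ p y)) (distribˡ (t i) _ _)) (v≈ (punchIn p i) y) ⟩
            t i *F (a p *F g y) +F t i *F w p y +F (a (punchIn p i) *F g y +F w (punchIn p i) y)
              ≈⟨ +-interchange _ _ _ _ ⟩
            t i *F (a p *F g y) +F a (punchIn p i) *F g y +F (t i *F w p y +F w (punchIn p i) y)
              ≈⟨ +-congʳ (trans (+-congʳ (sym (*-assoc _ _ _))) (sym (distribʳ (g y) _ _))) ⟩
            (t i *F a p +F a (punchIn p i)) *F g y +F (t i *F w p y +F w (punchIn p i) y)
              ≈⟨ +-congʳ (trans (*-congʳ (ta≈-a i)) (zeroˡ (g y))) ⟩
            0# +F (t i *F w p y +F w (punchIn p i) y)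
              ≈⟨ +-identityˡ _ ⟩
            t i *F w p y +F w (punchIn p i) y ∎

        indep′ : Independent v′
        indep′ x x⊥ i = trans (reflexive (≡.sym (insertAt-punchIn x p xₚ i))) (indep X X⊥ (punchIn p i))
          where
          -- A relation among the reduced vectors lifts to the original ones when the pivot vector
          -- receives the total weight with which it was added to them.
          xₚ : Carrier
          xₚ = sum (λ i → x i *F t i)

          X : Fin (suc r) → Carrier
          X = insertAt x p xₚ

          X⊥ : ∀ y → sum (λ i → X i *F v i y) ≈ 0#
          X⊥ y = begin
            sum (λ i → X i *F v i y)
              ≈⟨ sum-remove {i = p} (λ i → X i *F v i y) ⟩
            X p *F v p y +F sum (λ i → X (punchIn p i) *F v (punchIn p i) y)
              ≡⟨ cong₂ _+F_ (cong (_*F v p y) (insertAt-lookup x p xₚ))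
                   (sum-cong-≗ λ i → cong (_*F v (punchIn p i) y) (insertAt-punchIn x p xₚ i)) ⟩
            xₚ *F v p y +F sum (λ i → x i *F v (punchIn p i) y)
              ≈⟨ +-congʳ (*-distribʳ-sum (v p y) (λ i → x i *F t i)) ⟩
            sum (λ i → x i *F t i *F v p y) +F sum (λ i → x i *F v (punchIn p i) y)
              ≈⟨ ∑-distrib-+ (λ i → x i *F t i *F v p y) (λ i → x i *F v (punchIn p i) y) ⟨
            sum (λ i → x i *F t i *F v p y +F x i *F v (punchIn p i) y)
              ≈⟨ sum-cong-≋ (λ i → trans (+-congʳ (*-assoc _ _ _)) (sym (distribˡ (x i) _ _))) ⟩
            sum (λ i → x i *F v′ i y)
              ≈⟨ x⊥ y ⟩
            0# ∎

      v≈w : ∀ i y → v i y ≈ w i y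
      v≈w i y = begin
        v i y                   ≈⟨ v≈ i y ⟩
        a i *F g y +F w i y     ≈⟨ +-congʳ (*-congʳ (proj₁ (tight (a i) 0#) (¬pivot i))) ⟩
        0# *F g y +F w i y      ≈⟨ +-congʳ (zeroˡ (g y)) ⟩
        0# +F w i y             ≈⟨ +-identityˡ _ ⟩
        w i y                   ∎

    -- The order on ℕ is decidable, so the purely negative outcome of elimination suffices for a
    -- positive bound.
    independent-bound : ∀ {r} L (v : Fin r → Y → Carrier) →
                        (∀ i → Span L (v i)) → Independent v → r ≤ length L
    independent-bound L v v∈ indep = ℕₚ.≮⇒≥ λ L<r → ¬independent L L<r v v∈ indep

  -- Linear forms: degree, and splitting along a mask.

  ⋆-++ : ∀ {N} (p q : Poly F N) g m → ((p ++ q) ⋆ g) m ≈ (p ⋆ g) m +F (q ⋆ g) m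
  ⋆-++ []            q g m = sym (+-identityˡ _)
  ⋆-++ ((a , e) ∷ p) q g m = trans (+-congˡ (⋆-++ p q g m)) (sym (+-assoc _ _ _))

  ⋆-isLinearMap : ∀ {N} (p : Poly F N) → IsLinearMap (p ⋆_)
  ⋆-isLinearMap p = record
    { φ-zero   = ⋆-zero p
    ; φ-linear = λ a g w v≈ m → trans (⋆-cong p v≈ m) (⋆-linear p a g w m)
    }

  ∘-isLinearMap : ∀ {Y Z : Set} (h : Z → Y) → IsLinearMap (_∘ h)
  ∘-isLinearMap h = record { φ-zero = λ v≈0 z → v≈0 (h z) ; φ-linear = λ a g w v≈ z → v≈ (h z) }

  LinearTerms : ∀ {N} → Poly F N → Set c
  LinearTerms = All (λ t → Vec.sum (proj₂ t) ≡ 1)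

  TermsSupportedOn : ∀ {N} → Vec Bool N → Poly F N → Set c
  TermsSupportedOn M = All (λ t → SupportedOn M (proj₂ t))

  coeff-linearTerms : ∀ {N} {p : Poly F N} → LinearTerms p → ∀ m → Vec.sum m ≢ 1 → coeff F p m ≈ 0#
  coeff-linearTerms {p = []}          []             m m≢1 = refl
  coeff-linearTerms {p = (a , e) ∷ p} (e≡1 ∷ linear) m m≢1 = begin
    coeff F ((a , e) ∷ p) m      ≈⟨ coeff-∷ a e p m ⟩
    a *F δ e m +F coeff F p m    ≈⟨ +-cong (*-congˡ (δ-off e m λ e≡m → m≢1 (≡.trans (cong Vec.sum (≡.sym e≡m)) e≡1)))
                                           (coeff-linearTerms linear m m≢1) ⟩
    a *F 0# +F 0#                ≈⟨ +-identityʳ _ ⟩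
    a *F 0#                      ≈⟨ zeroʳ a ⟩
    0#                           ∎

  linear? : ∀ {N} (t : Carrier × Monomial N) → Dec (Vec.sum (proj₂ t) ≡ 1)
  linear? t = Vec.sum (proj₂ t) ℕₚ.≟ 1

  -- A homogeneous form may still list terms of other degrees whose coefficients cancel. Discarding
  -- them keeps every coefficient and makes the degree visible term by term.
  linearPart : ∀ {N} → Poly F N → Poly F N
  linearPart = List.filter linear?

  coeff-linearPart : ∀ {N} (p : Poly F N) m → Vec.sum m ≡ 1 → coeff F (linearPart p) m ≈ coeff F p m
  coeff-linearPart []            m m≡1 = refl
  coeff-linearPart ((a , e) ∷ p) m m≡1 with linear? (a , e)
  ... | yes e≡1 = begin
    coeff F (linearPart ((a , e) ∷ p)) m    ≡⟨ cong (λ q → coeff F q m) (Listₚ.filter-accept linear? {a , e} {p} e≡1) ⟩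
    coeff F ((a , e) ∷ linearPart p) m      ≈⟨ coeff-∷ a e (linearPart p) m ⟩
    a *F δ e m +F coeff F (linearPart p) m  ≈⟨ +-congˡ (coeff-linearPart p m m≡1) ⟩
    a *F δ e m +F coeff F p m               ≈⟨ coeff-∷ a e p m ⟨
    coeff F ((a , e) ∷ p) m                 ∎
  ... | no  e≢1 = begin
    coeff F (linearPart ((a , e) ∷ p)) m    ≡⟨ cong (λ q → coeff F q m) (Listₚ.filter-reject linear? {a , e} {p} e≢1) ⟩
    coeff F (linearPart p) m                ≈⟨ coeff-linearPart p m m≡1 ⟩
    coeff F p m                             ≈⟨ +-identityˡ _ ⟨
    0# +F coeff F p m                       ≈⟨ +-congʳ (zeroʳ a) ⟨
    a *F 0# +F coeff F p m                  ≈⟨ +-congʳ (*-congˡ (δ-off e m λ e≡m → e≢1 (≡.trans (cong Vec.sum e≡m) m≡1))) ⟨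
    a *F δ e m +F coeff F p m               ≈⟨ coeff-∷ a e p m ⟨
    coeff F ((a , e) ∷ p) m                 ∎

  homogeneous⇒linearPart : ∀ {N} (p : Poly F N) → IsHomogeneousLinear F p → _≈ₚ_ F p (linearPart p)
  homogeneous⇒linearPart p hom m with Vec.sum m ℕₚ.≟ 1
  ... | yes m≡1 = sym (coeff-linearPart p m m≡1)
  ... | no  m≢1 = trans (hom m m≢1) (sym (coeff-linearTerms (all-filter linear? p) m m≢1))

  ⋆-degree : ∀ {N} {p : Poly F N} {g k} → LinearTerms p → (∀ m → Vec.sum m ≢ k → g m ≈ 0#) →
             ∀ m → Vec.sum m ≢ suc k → (p ⋆ g) m ≈ 0#
  ⋆-degree {p = []}          []             g≈0 m m≢ = refl
  ⋆-degree {p = (a , e) ∷ p} {g} (e≡1 ∷ linear) g≈0 m m≢ = begin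
    a *F shift e g m +F (p ⋆ g) m   ≈⟨ +-cong (*-congˡ (shift-vanish e g g≈0′)) (⋆-degree linear g≈0 m m≢) ⟩
    a *F 0# +F 0#                   ≈⟨ +-identityʳ _ ⟩
    a *F 0#                         ≈⟨ zeroʳ a ⟩
    0#                              ∎
    where
    g≈0′ : ∀ k → m ≡ e ⊕ k → g k ≈ 0#
    g≈0′ k ≡.refl = g≈0 k λ k≡ → m≢ (≡.trans (sum-⊕ e k) (cong₂ ℕ._+_ e≡1 k≡))

  coeff-1ₚ : ∀ {N} (m : Monomial N) → coeff F (1ₚ F) m ≈ δ (𝟎) m
  coeff-1ₚ {N} m = trans (coeff-∷ 1# (𝟎) [] m) (trans (+-identityʳ _) (*-identityˡ _))

  product-degree : ∀ {N} {ls : List (Poly F N)} → All (IsHomogeneousLinear F) ls →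
                   ∀ m → Vec.sum m ≢ length ls → coeff F (productₚ F ls) m ≈ 0#
  product-degree {N} {[]}     []         m m≢0 =
    trans (coeff-1ₚ m) (δ-off (𝟎) m λ { ≡.refl → m≢0 (sum-𝟎 N) })
  product-degree {ls = l ∷ ls} (hom ∷ homs) m m≢ = begin
    coeff F (_*ₚ_ F l (productₚ F ls)) m                ≈⟨ *ₚ-congˡ l (linearPart l) (homogeneous⇒linearPart l hom) (productₚ F ls) m ⟩
    coeff F (_*ₚ_ F (linearPart l) (productₚ F ls)) m   ≈⟨ coeff-* (linearPart l) (productₚ F ls) m ⟩
    (linearPart l ⋆ coeff F (productₚ F ls)) m          ≈⟨ ⋆-degree (all-filter linear? l) (product-degree homs) m m≢ ⟩
    0#                                                  ∎

  split : ∀ {N} (M : Vec Bool N) {p : Poly F N} → LinearTerms p →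
    ∃₂ λ pˡ pʳ → TermsSupportedOn M pˡ × TermsSupportedOn (Vec.map not M) pʳ × _≈ₚ_ F p (pˡ ++ pʳ)
  split M {[]}          []             = [] , [] , [] , [] , λ _ → refl
  split M {(a , e) ∷ p} (e≡1 ∷ linear)
    with degree1-supported M e e≡1 | split M linear
  ... | inj₁ onM  | pˡ , pʳ , allˡ , allʳ , p≈ = (a , e) ∷ pˡ , pʳ , onM ∷ allˡ , allʳ , λ m → begin
    coeff F ((a , e) ∷ p) m                              ≈⟨ coeff-∷ a e p m ⟩
    a *F δ e m +F coeff F p m                            ≈⟨ +-congˡ (p≈ m) ⟩
    a *F δ e m +F coeff F (pˡ ++ pʳ) m                   ≈⟨ coeff-∷ a e (pˡ ++ pʳ) m ⟨
    coeff F ((a , e) ∷ pˡ ++ pʳ) m                       ∎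
  ... | inj₂ offM | pˡ , pʳ , allˡ , allʳ , p≈ = pˡ , (a , e) ∷ pʳ , allˡ , offM ∷ allʳ , λ m → begin
    coeff F ((a , e) ∷ p) m                              ≈⟨ coeff-∷ a e p m ⟩
    a *F δ e m +F coeff F p m                            ≈⟨ +-congˡ (trans (p≈ m) (coeff-++ pˡ pʳ m)) ⟩
    a *F δ e m +F (coeff F pˡ m +F coeff F pʳ m)         ≈⟨ +-swap _ _ _ ⟩
    coeff F pˡ m +F (a *F δ e m +F coeff F pʳ m)         ≈⟨ +-congˡ (coeff-∷ a e pʳ m) ⟨
    coeff F pˡ m +F coeff F ((a , e) ∷ pʳ) m             ≈⟨ coeff-++ pˡ ((a , e) ∷ pʳ) m ⟨
    coeff F (pˡ ++ (a , e) ∷ pʳ) m                       ∎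

  -- Row spans of products of linear forms.

  module _ {N} (M : Vec Bool N) where

    -- Terms off the mask touch only the column index, so multiplication by `p` applies one linear
    -- map, the same for every `x`, to each row.
    ⋆-mixʳ : ∀ {p} → TermsSupportedOn (Vec.map not M) p → ∀ g x y →
             (p ⋆ g) (mix M x y) ≈ (p ⋆ (λ y′ → g (mix M x y′))) y
    ⋆-mixʳ {[]}          []           g x y = refl
    ⋆-mixʳ {(a , e) ∷ p} (supp ∷ all) g x y = +-cong (*-congˡ (shift-mixʳ supp g x y)) (⋆-mixʳ all g x y)

    -- The new row at `x` is the old row at the quotient `k` if `e` divides `x`, and zero otherwise;
    -- no new generator arises.
    span-shift : ∀ {e} → SupportedOn M e → ∀ {L g} → (∀ x → Span L (λ y → g (mix M x y))) →
                 ∀ x → Span L (λ y → shift e g (mix M x y))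
    span-shift {e} supp {L} {g} g∈ x = span-cong L (shift-mixˡ supp g x) shifted
      where
      shifted : Span L (λ y → shift e (λ x′ → g (mix M x′ y)) x)
      shifted with divide? e x
      ... | yes (k , _) = g∈ k
      ... | no  _       = span-zero L (λ _ → refl)

    span-⋆ : ∀ {p} → TermsSupportedOn M p → ∀ {L g} → (∀ x → Span L (λ y → g (mix M x y))) →
             ∀ x → Span L (λ y → (p ⋆ g) (mix M x y))
    span-⋆ {[]}          []           {L} g∈ x = span-zero L (λ _ → refl)
    span-⋆ {(a , e) ∷ p} (supp ∷ all) {L} g∈ x =
      span-linear L a (span-shift supp g∈ x) (span-⋆ all g∈ x)

    -- Writing each linear form as its part on M plus its part off M, the product
    -- expands into 2^D terms, each a polynomial on M times a polynomial off M.
    product-span : ∀ {ls} → All (IsHomogeneousLinear F) ls →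
      ∃ λ L → length L ≡ 2 ^ length ls × (∀ x → Span L (λ y → coeff F (productₚ F ls) (mix M x y)))
    product-span {[]}     []           = (λ y → δ 𝟎 (mix M 𝟎 y)) ∷ [] , ≡.refl , λ x →
      span-cong (_ ∷ []) (λ y → coeff-1ₚ (mix M x y)) (constant x)
      where
      constant : ∀ x → Span ((λ y → δ 𝟎 (mix M 𝟎 y)) ∷ []) (λ y → δ 𝟎 (mix M x y))
      -- The test asks whether `x` vanishes on the mask: such rows all equal the row at `𝟎`, and
      -- every other row is zero.
      constant x with Vecₚ.≡-dec ℕₚ._≟_ 𝟎 (mix M x 𝟎)
      ... | yes 𝟎≡ = 1# , (λ _ → 0#) , Level.lift (λ _ → refl) , λ y →
        trans (reflexive (cong (δ 𝟎) (≡.trans (≡.sym (mix-absorbˡ M x 𝟎 y)) (cong (λ z → mix M z y) (≡.sym 𝟎≡)))))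
              (sym (trans (+-identityʳ _) (*-identityˡ _)))
      ... | no  𝟎≢ = span-zero (_ ∷ []) λ y → δ-off 𝟎 (mix M x y) λ 𝟎≡ → 𝟎≢
        (≡.trans (≡.sym (mix-idem M 𝟎)) (≡.trans (cong (λ z → mix M z 𝟎) 𝟎≡) (mix-absorbˡ M x y 𝟎)))
    product-span {l ∷ ls} (hom ∷ homs)
      with product-span homs | split M (all-filter linear? l)
    ... | L , len , q∈L | lˡ , lʳ , onM , offM , l≈ =
      L ++ List.map (lʳ ⋆_) L , len′ , λ x → span-cong (L ++ List.map (lʳ ⋆_) L) (row≈ x)
        (span-++ L (span-⋆ onM q∈L x)
          (span-cong (List.map (lʳ ⋆_) L) (⋆-mixʳ offM (coeff F q) x) (span-map (⋆-isLinearMap lʳ) L (q∈L x))))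
      where
      q : Poly F N
      q = productₚ F ls

      len′ : length (L ++ List.map (lʳ ⋆_) L) ≡ 2 ^ suc (length ls)
      len′ = ≡.trans (Listₚ.length-++ L) (cong₂ ℕ._+_ len
        (≡.trans (Listₚ.length-map (lʳ ⋆_) L) (≡.trans len (≡.sym (ℕₚ.+-identityʳ _)))))

      row≈ : ∀ x y → coeff F (_*ₚ_ F l q) (mix M x y) ≈
             (lˡ ⋆ coeff F q) (mix M x y) +F (lʳ ⋆ coeff F q) (mix M x y)
      row≈ x y = begin
        coeff F (_*ₚ_ F l q) m                     ≈⟨ *ₚ-congˡ l (lˡ ++ lʳ) l≈ˡʳ q m ⟩
        coeff F (_*ₚ_ F (lˡ ++ lʳ) q) m            ≈⟨ coeff-* (lˡ ++ lʳ) q m ⟩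
        ((lˡ ++ lʳ) ⋆ coeff F q) m                 ≈⟨ ⋆-++ lˡ lʳ (coeff F q) m ⟩
        (lˡ ⋆ coeff F q) m +F (lʳ ⋆ coeff F q) m   ∎
        where
        m = mix M x y

        l≈ˡʳ : _≈ₚ_ F l (lˡ ++ lʳ)
        l≈ˡʳ m′ = trans (homogeneous⇒linearPart l hom m′) (l≈ m′)

    module _ {d r} (W : Fin r → Monomial N) (W-degree : ∀ i j → Vec.sum (mix M (W i) (W j)) ≡ d) where

      product-span-degree : ∀ {ls} → All (IsHomogeneousLinear F) ls →
        ∃ λ L → length L ≤ 2 ^ d × (∀ i → Span L (λ j → coeff F (productₚ F ls) (mix M (W i) (W j))))
      product-span-degree {ls} homs with d ℕₚ.≟ length ls
      ... | yes ≡.refl = let L , len , q∈L = product-span homs in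
        List.map (_∘ W) L
        , ℕₚ.≤-reflexive (≡.trans (Listₚ.length-map (_∘ W) L) len)
        , λ i → span-map (∘-isLinearMap W) L (q∈L (W i))
      ... | no  d≢     = [] , z≤n , λ i → Level.lift λ j →
        product-degree homs _ λ deg → d≢ (≡.trans (≡.sym (W-degree i j)) deg)

      -- The row span of a homogeneous circuit.

      module _ (C : ΣΠΣCircuit F N) (hom : ΣΠΣCircuit.Homogeneous C) where
        open ΣΠΣCircuit C

        bottoms-homogeneous : ∀ ss → All (IsHomogeneousLinear F) (List.map bottomValue ss)
        bottoms-homogeneous []       = []
        bottoms-homogeneous (s ∷ ss) = hom s ∷ bottoms-homogeneous ss

        gateBasis : Fin #products → List (Fin r → Carrier)
        gateBasis p = proj₁ (product-span-degree (bottoms-homogeneous (List⁺.toList (middle p))))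

        -- Collected over the product gates rather than over the wires into the top gate, so a gate
        -- wired several times is counted once.
        basis : List (Fin r → Carrier)
        basis = List.concat (List.tabulate gateBasis)

        length-basis : length basis ≤ #products * 2 ^ d
        length-basis = length-concat gateBasis λ p →
          proj₁ (proj₂ (product-span-degree (bottoms-homogeneous (List⁺.toList (middle p)))))
          where
          length-concat : ∀ {k b} (Ls : Fin k → List (Fin r → Carrier)) → (∀ i → length (Ls i) ≤ b) →
                          length (List.concat (List.tabulate Ls)) ≤ k * b
          length-concat {zero}  Ls Ls≤b = z≤n
          length-concat {suc k} Ls Ls≤b = ℕₚ.≤-trans (ℕₚ.≤-reflexive (Listₚ.length-++ (Ls zero)))
            (ℕₚ.+-mono-≤ (Ls≤b zero) (length-concat (Ls ∘ suc) (Ls≤b ∘ suc)))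

        gates-span : ∀ ps i → Span basis (λ j → coeff F (sumₚ F (List.map middleValue ps)) (mix M (W i) (W j)))
        gates-span []       i = span-zero basis (λ _ → refl)
        gates-span (p ∷ ps) i = span-cong basis
          (λ j → coeff-++ (middleValue p) (sumₚ F (List.map middleValue ps)) (mix M (W i) (W j)))
          (span-+ basis
            (span-concat gateBasis p
              (proj₂ (proj₂ (product-span-degree (bottoms-homogeneous (List⁺.toList (middle p))))) i))
            (gates-span ps i))

        independent⇒#products : Independent (λ i j → coeff F output (mix M (W i) (W j))) → r ≤ #products * 2 ^ d
        independent⇒#products indep = ℕₚ.≤-trans
          (independent-bound basis _ (gates-span (List⁺.toList top)) indep) length-basis

  -- Coefficients of the iterated matrix product.

  δ-++ : ∀ {k N} (u u′ : Monomial k) (m m′ : Monomial N) →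
         δ (u Vec.++ m) (u′ Vec.++ m′) ≈ δ u u′ *F δ m m′
  δ-++ u u′ m m′ with Vecₚ.≡-dec ℕₚ._≟_ u u′ | Vecₚ.≡-dec ℕₚ._≟_ m m′
  ... | yes ≡.refl | yes ≡.refl = trans (δ-diag {e = u Vec.++ m} ≡.refl) (sym (*-identityˡ 1#))
  ... | yes _      | no  m≢m′   = trans (δ-off _ _ (m≢m′ ∘ Vecₚ.++-injectiveʳ u u′)) (sym (*-identityˡ 0#))
  ... | no  u≢u′   | _          = trans (δ-off _ _ (u≢u′ ∘ Vecₚ.++-injectiveˡ u u′)) (sym (zeroˡ _))

  -- The ring embedding F[x₀,…,x_{N-1}] → F[x₀,…,x_{k+N-1}], xᵢ ↦ x_{k+i}.
  weaken : ∀ k {N} → Poly F N → Poly F (k ℕ.+ N)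
  weaken k = List.map λ (a , e) → a , 𝟎 {k} Vec.++ e

  weaken-* : ∀ k {N} (p q : Poly F N) → _*ₚ_ F (weaken k p) (weaken k q) ≡ weaken k (_*ₚ_ F p q)
  weaken-* k []            q = ≡.refl
  weaken-* k ((a , e) ∷ p) q = ≡.trans
    (cong₂ _++_ (termTimes-weaken q) (weaken-* k p q))
    (≡.sym (Listₚ.map-++ _ (termTimes a e q) (_*ₚ_ F p q)))
    where
    termTimes-weaken : ∀ q → termTimes a (𝟎 {k} Vec.++ e) (weaken k q) ≡ weaken k (termTimes a e q)
    termTimes-weaken []             = ≡.refl
    termTimes-weaken ((b , e′) ∷ q) = cong₂ _∷_
      (cong (a *F b ,_) (≡.trans (Vecₚ.zipWith-++ ℕ._+_ (𝟎 {k}) e 𝟎 e′)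
        (cong (Vec._++ (e ⊕ e′)) (Vecₚ.zipWith-replicate ℕ._+_ 0 0))))
      (termTimes-weaken q)

  Σₚ : ∀ {n N} → (Fin n → Poly F N) → Poly F N
  Σₚ = foldr (_+ₚ_ F) (0ₚ F)

  coeff-Σₚ : ∀ {n N} (P : Fin n → Poly F N) m → coeff F (Σₚ P) m ≈ sum (λ k → coeff F (P k) m)
  coeff-Σₚ {zero}  P m = refl
  coeff-Σₚ {suc n} P m = trans (coeff-++ (P zero) (Σₚ (P ∘ suc)) m) (+-congˡ (coeff-Σₚ (P ∘ suc) m))

  weaken-Σₚ : ∀ k {n N} {P : Fin n → Poly F N} {Q} → (∀ i → Q i ≡ weaken k (P i)) → Σₚ Q ≡ weaken k (Σₚ P)
  weaken-Σₚ k {zero}          Q≡ = ≡.refl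
  weaken-Σₚ k {suc n} {P = P} Q≡ = ≡.trans (cong₂ _++_ (Q≡ zero) (weaken-Σₚ k (Q≡ ∘ suc)))
    (≡.sym (Listₚ.map-++ _ (P zero) (Σₚ (P ∘ suc))))

  -- Applied to all factors but the first, whose variables avoid the first block: their product is
  -- an embedded copy of the shorter product, even as a list of terms.
  weaken-matrixProduct : ∀ k {d n N} (A : Fin d → Matrix F n N) (B : Fin d → Matrix F n (k ℕ.+ N)) →
    (∀ i j l → B i j l ≡ weaken k (A i j l)) → ∀ j l → matrixProduct F B j l ≡ weaken k (matrixProduct F A j l)
  weaken-matrixProduct k {zero}  A B B≡ j l with does (j Fin.≟ l)
  ... | true  = cong (λ e → (1# , e) ∷ []) (𝟎-++ k)
  ... | false = ≡.refl
  weaken-matrixProduct k {suc d} A B B≡ j l = weaken-Σₚ k λ i → ≡.trans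
    (cong₂ (_*ₚ_ F) (B≡ zero j i) (weaken-matrixProduct k (A ∘ suc) (B ∘ suc) (B≡ ∘ suc) i l))
    (weaken-* k (A zero j i) (matrixProduct F (A ∘ suc) i l))

  -- The exponents of the first block come only from the variable and the others only from `p`, so
  -- the coefficient factors.
  coeff-var-*-weaken : ∀ {k N} (v : Fin k) (p : Poly F N) u m →
    coeff F (_*ₚ_ F (varₚ F (v ↑ˡ N)) (weaken k p)) (u Vec.++ m) ≈ δ (unit v) u *F coeff F p m
  coeff-var-*-weaken {k} {N} v p u m = begin
    coeff F (termTimes 1# (unit (v ↑ˡ N)) (weaken k p) ++ []) (u Vec.++ m)
      ≡⟨ cong (λ q → coeff F q (u Vec.++ m)) (Listₚ.++-identityʳ (termTimes 1# (unit (v ↑ˡ N)) (weaken k p))) ⟩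
    coeff F (termTimes 1# (unit (v ↑ˡ N)) (weaken k p)) (u Vec.++ m)
      ≈⟨ terms p ⟩
    δ (unit v) u *F coeff F p m ∎
    where
    unit-⊕ : ∀ e → unit (v ↑ˡ N) ⊕ (𝟎 Vec.++ e) ≡ unit v Vec.++ e
    unit-⊕ e = ≡.trans (cong (_⊕ (𝟎 Vec.++ e)) (unit-↑ˡ v N))
      (≡.trans (Vecₚ.zipWith-++ ℕ._+_ (unit v) 𝟎 𝟎 e)
        (cong₂ Vec._++_ (Vecₚ.zipWith-identityʳ ℕₚ.+-identityʳ (unit v)) (Vecₚ.zipWith-identityˡ ℕₚ.+-identityˡ e)))

    terms : ∀ p → coeff F (termTimes 1# (unit (v ↑ˡ N)) (weaken k p)) (u Vec.++ m) ≈ δ (unit v) u *F coeff F p m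
    terms []            = sym (zeroʳ _)
    terms ((b , e) ∷ p) = begin
      coeff F (termTimes 1# (unit (v ↑ˡ N)) (weaken k ((b , e) ∷ p))) (u Vec.++ m)
        ≈⟨ coeff-∷ (1# *F b) (unit (v ↑ˡ N) ⊕ (𝟎 Vec.++ e)) (termTimes 1# (unit (v ↑ˡ N)) (weaken k p)) (u Vec.++ m) ⟩
      1# *F b *F δ (unit (v ↑ˡ N) ⊕ (𝟎 Vec.++ e)) (u Vec.++ m) +F
        coeff F (termTimes 1# (unit (v ↑ˡ N)) (weaken k p)) (u Vec.++ m)
        ≈⟨ +-cong (*-cong (*-identityˡ b) (trans (reflexive (cong (λ e′ → δ e′ (u Vec.++ m)) (unit-⊕ e)))
                                                 (δ-++ (unit v) u e m)))
                  (terms p) ⟩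
      b *F (δ (unit v) u *F δ e m) +F δ (unit v) u *F coeff F p m
        ≈⟨ +-congʳ (*-swap b _ _) ⟩
      δ (unit v) u *F (b *F δ e m) +F δ (unit v) u *F coeff F p m
        ≈⟨ distribˡ _ _ _ ⟨
      δ (unit v) u *F (b *F δ e m +F coeff F p m)
        ≈⟨ *-congˡ (coeff-∷ b e p m) ⟨
      δ (unit v) u *F coeff F ((b , e) ∷ p) m ∎

  sum-single : ∀ {n} j {t : Fin n → Carrier} → (∀ i → i ≢ j → t i ≈ 0#) → sum t ≈ t j
  sum-single {suc n} j {t} t≈0 = begin
    sum t                       ≈⟨ sum-remove {i = j} t ⟩
    t j +F sum (removeAt t j)   ≈⟨ +-congˡ (sum-cong-≋ λ i → t≈0 (punchIn j i) (Fin.punchInᵢ≢i j i)) ⟩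
    t j +F sum {n} (λ _ → 0#)   ≈⟨ +-congˡ (sum-replicate-zero n) ⟩
    t j +F 0#                   ≈⟨ +-identityʳ (t j) ⟩
    t j                         ∎

  sum-zero : ∀ {n} {t : Fin n → Carrier} → (∀ i → t i ≈ 0#) → sum t ≈ 0#
  sum-zero {n} t≈0 = trans (sum-cong-≋ t≈0) (sum-replicate-zero n)

  module _ (n : ℕ) where

    entry : ∀ d → Fin n → Fin n → Poly F (d * (n * n))
    entry d = matrixProduct F (variableMatrix F n d)

    -- Expansion along the first matrix: a nonzero summand needs `u` to be the edge from `a` to `k`,
    -- and the remaining product starts at `k`.
    coeff-entry : ∀ d a b u m →
      coeff F (entry (suc d) a b) (u Vec.++ m) ≈ sum (λ k → δ (unit (combine a k)) u *F coeff F (entry d k b) m)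
    coeff-entry d a b u m = trans
      (coeff-Σₚ (λ k → _*ₚ_ F (varₚ F (combine a k ↑ˡ (d * (n * n)))) (tail k)) (u Vec.++ m))
      (sum-cong-≋ λ k → trans
        (reflexive (cong (λ p → coeff F (_*ₚ_ F (varₚ F (combine a k ↑ˡ (d * (n * n)))) p) (u Vec.++ m)) (tail≡ k)))
        (coeff-var-*-weaken (combine a k) (entry d k b) u m))
      where
      tail : Fin n → Poly F (suc d * (n * n))
      tail k = matrixProduct F (variableMatrix F n (suc d) ∘ suc) k b

      tail≡ : ∀ k → tail k ≡ weaken (n * n) (entry d k b)
      tail≡ k = weaken-matrixProduct (n * n) (variableMatrix F n d) (variableMatrix F n (suc d) ∘ suc)
        (λ i j l → cong (λ e → (1# , e) ∷ []) (unit-↑ʳ (n * n) (combine i (combine j l)))) k b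

    δ-edge-off : ∀ (a a′ k k′ : Fin n) x → (a ≡ a′ → k ≡ k′ → x ≈ 0#) →
                 δ (unit (combine a k)) (unit (combine a′ k′)) *F x ≈ 0#
    δ-edge-off a a′ k k′ x x≈0 with a Fin.≟ a′ | k Fin.≟ k′
    ... | yes a≡a′ | yes k≡k′ = trans (*-congˡ (x≈0 a≡a′ k≡k′)) (zeroʳ _)
    ... | yes _    | no  k≢k′ = trans (*-congʳ (δ-off (unit (combine a k)) (unit (combine a′ k′))
      (k≢k′ ∘ Fin.combine-injectiveʳ a k a′ k′ ∘ unit-injective))) (zeroˡ x)
    ... | no  a≢a′ | _        = trans (*-congʳ (δ-off (unit (combine a k)) (unit (combine a′ k′))
      (a≢a′ ∘ Fin.combine-injectiveˡ a k a′ k′ ∘ unit-injective))) (zeroˡ x)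

    coeff-entry-edge : ∀ d a b k m →
      coeff F (entry (suc d) a b) (unit (combine a k) Vec.++ m) ≈ coeff F (entry d k b) m
    coeff-entry-edge d a b k m = begin
      coeff F (entry (suc d) a b) (unit (combine a k) Vec.++ m)
        ≈⟨ coeff-entry d a b (unit (combine a k)) m ⟩
      sum (λ l → δ (unit (combine a l)) (unit (combine a k)) *F coeff F (entry d l b) m)
        ≈⟨ sum-single k (λ l l≢k → δ-edge-off a a l k _ λ _ l≡k → contradiction l≡k l≢k) ⟩
      δ (unit (combine a k)) (unit (combine a k)) *F coeff F (entry d k b) m
        ≈⟨ *-congʳ (δ-diag {e = unit (combine a k)} ≡.refl) ⟩
      1# *F coeff F (entry d k b) m
        ≈⟨ *-identityˡ _ ⟩
      coeff F (entry d k b) m ∎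

    coeff-entry-walk : ∀ d a b w → coeff F (entry (suc d) a b) (walk n d a b w) ≈ 1#
    coeff-entry-walk zero    a b []      = trans (coeff-entry-edge 0 a b b []) identity-diag
      where
      identity-diag : coeff F (entry 0 b b) [] ≈ 1#
      identity-diag with b Fin.≟ b
      ... | yes _   = +-identityʳ 1#
      ... | no  b≢b = contradiction ≡.refl b≢b
    coeff-entry-walk (suc d) a b (k ∷ w) =
      trans (coeff-entry-edge (suc d) a b k (walk n d k b w)) (coeff-entry-walk d k b w)

    -- If the mixture of two walks is itself a walk, then consecutive layers,
    -- taken alternately from the two, must match, so that the walks coincide.
    coeff-entry-mix : ∀ d a a′ b w w′ → a′ ∷ w′ ≢ a ∷ w →
      coeff F (entry (suc d) a b) (mix (oddLayers n (suc d)) (walk n d a′ b w′) (walk n d a b w)) ≈ 0#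
    coeff-entry-mix zero a a′ b [] [] a′≢a = begin
      coeff F (entry 1 a b) (mix (oddLayers n 1) (walk n 0 a′ b []) (walk n 0 a b []))
        ≡⟨ cong (coeff F (entry 1 a b)) (mix-oddLayers n 0 (unit (combine a′ b)) (unit (combine a b)) [] []) ⟩
      coeff F (entry 1 a b) (unit (combine a′ b) Vec.++ [])
        ≈⟨ coeff-entry 0 a b (unit (combine a′ b)) [] ⟩
      sum (λ l → δ (unit (combine a l)) (unit (combine a′ b)) *F coeff F (entry 0 l b) [])
        ≈⟨ sum-zero (λ l → δ-edge-off a a′ l b _ λ a≡a′ _ → contradiction (cong (_∷ []) (≡.sym a≡a′)) a′≢a) ⟩
      0# ∎
    coeff-entry-mix (suc d) a a′ b (k ∷ w) (k′ ∷ w′) w′≢w = begin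
      coeff F (entry (2 ℕ.+ d) a b) (mix (oddLayers n (2 ℕ.+ d)) (walk n (suc d) a′ b (k′ ∷ w′)) (walk n (suc d) a b (k ∷ w)))
        ≡⟨ cong (coeff F (entry (2 ℕ.+ d) a b)) (mix-oddLayers n (suc d) (unit (combine a′ k′)) (unit (combine a k)) _ _) ⟩
      coeff F (entry (2 ℕ.+ d) a b) (unit (combine a′ k′) Vec.++ m)
        ≈⟨ coeff-entry (suc d) a b (unit (combine a′ k′)) m ⟩
      sum (λ l → δ (unit (combine a l)) (unit (combine a′ k′)) *F coeff F (entry (suc d) l b) m)
        ≈⟨ sum-zero (λ l → δ-edge-off a a′ l k′ _ (tail≈0 l)) ⟩
      0# ∎
      where
      m = mix (oddLayers n (suc d)) (walk n d k b w) (walk n d k′ b w′)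

      tail≈0 : ∀ l → a ≡ a′ → l ≡ k′ → coeff F (entry (suc d) l b) m ≈ 0#
      -- The walks trade places. The invariant is that the entry starts where the second monomial of
      -- the mixture starts, here at `k′`.
      tail≈0 l a≡a′ ≡.refl = coeff-entry-mix d l k b w′ w λ kw≡k′w′ →
        w′≢w (cong₂ _∷_ (≡.sym a≡a′) (≡.sym kw≡k′w′))

  -- Counting product gates.

  #products-bound : ∀ n d (1≤n : 1 ≤ n) (C : ΣΠΣCircuit F (suc d * (n * n))) →
    ΣΠΣCircuit.Homogeneous C → ΣΠΣCircuit.Computes C (matrixProduct₁₁ F n (suc d) 1≤n) →
    n ^ d ≤ ΣΠΣCircuit.#products C * 2 ^ suc d
  #products-bound n d 1≤n C hom comp =
    independent⇒#products M W (λ i j → sum-mix-walk n d a a a (vertices n d i) (vertices n d j)) C hom indep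
    where
    a : Fin n
    a = fromℕ< 1≤n

    M : Vec Bool (suc d * (n * n))
    M = oddLayers n (suc d)

    W : Fin (n ^ d) → Monomial (suc d * (n * n))
    W i = walk n d a a (vertices n d i)

    diag : ∀ i → coeff F (ΣΠΣCircuit.output C) (mix M (W i) (W i)) ≈ 1#
    diag i = trans (comp (mix M (W i) (W i))) (trans
      (reflexive (cong (coeff F (entry n (suc d) a a)) (mix-idem M (W i))))
      (coeff-entry-walk n d a a (vertices n d i)))

    off : ∀ i j → i ≢ j → coeff F (ΣΠΣCircuit.output C) (mix M (W i) (W j)) ≈ 0#
    off i j i≢j = trans (comp (mix M (W i) (W j)))
      (coeff-entry-mix n d a a a (vertices n d j) (vertices n d i) (i≢j ∘ vertices-injective n d ∘ Vecₚ.∷-injectiveʳ))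

    indep : Independent (λ i j → coeff F (ΣΠΣCircuit.output C) (mix M (W i) (W j)))
    -- Column `j` of the identity matrix isolates the coefficient `x j`.
    indep x x⊥ j = begin
      x j
        ≈⟨ *-identityʳ (x j) ⟨
      x j *F 1#
        ≈⟨ *-congˡ (diag j) ⟨
      x j *F coeff F (ΣΠΣCircuit.output C) (mix M (W j) (W j))
        ≈⟨ sum-single j (λ i i≢j → trans (*-congˡ (off i j i≢j)) (zeroʳ (x i))) ⟨
      sum (λ i → x i *F coeff F (ΣΠΣCircuit.output C) (mix M (W i) (W j)))
        ≈⟨ x⊥ j ⟩
      0# ∎

-- Division in ℚ reduces fractions, so the comparison moves to unnormalised rationals, where it is
-- cross multiplication.
ratio-bound : ∀ m b k .{{_ : ℕ.NonZero b}} → m ≤ k * b → ℚ.1ℚ ℚ.* (+ m / b) ℚ.≤ + k / 1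
ratio-bound m b@(suc _) k m≤kb = ≡.subst (ℚ._≤ + k / 1) (≡.sym (ℚₚ.*-identityˡ (+ m / b)))
  (ℚₚ.toℚᵘ-cancel-≤ (ℚᵘₚ.≤-trans (ℚᵘₚ.≤-reflexive (ℚₚ.toℚᵘ-fromℚᵘ (ℚᵘ.mkℚᵘ (+ m) _)))
    (ℚᵘₚ.≤-trans (ℚᵘ.*≤* m*1≤k*b) (ℚᵘₚ.≤-reflexive (ℚᵘₚ.≃-sym (ℚₚ.toℚᵘ-fromℚᵘ (ℚᵘ.mkℚᵘ (+ k) 0)))))))
  where
  m*1≤k*b : + m ℤ.* + 1 ℤ.≤ + k ℤ.* + b
  m*1≤k*b = ≡.subst₂ ℤ._≤_ (ℤₚ.pos-* m 1) (ℤₚ.pos-* k b)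
    (ℤ.+≤+ (≡.subst (_≤ k * b) (≡.sym (ℕₚ.*-identityʳ m)) m≤kb))

theorem5 : ∀ {c ℓ₁ ℓ₂} →
    ∃[ ε ] 0ℚ ℚ.< ε ×
    ((F : HeytingField c ℓ₁ ℓ₂) (n d : ℕ) (1≤n : 1 ≤ n) → 1 ≤ d →
    (C : ΣΠΣCircuit F (d * (n * n))) →
    ΣΠΣCircuit.Homogeneous C →
    ΣΠΣCircuit.Computes C (matrixProduct₁₁ F n d 1≤n) →
    ε ℚ.* (_/_ (+ (n ^ (d ∸ 1))) (2 ^ d) {{m^n≢0 2 d}}) ℚ.≤ (+ ΣΠΣCircuit.size C) / 1)
-- Matching on `suc d` lets `d ∸ 1` compute to the number of interior vertices.
theorem5 = ℚ.1ℚ , ℚₚ.positive⁻¹ ℚ.1ℚ , λ { F n (suc d) 1≤n _ C hom comp →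
  ratio-bound (n ^ d) (2 ^ suc d) (ΣΠΣCircuit.size C) {{m^n≢0 2 (suc d)}}
    (ℕₚ.≤-trans (#products-bound F n d 1≤n C hom comp)
      (ℕₚ.*-monoˡ-≤ (2 ^ suc d) (#products≤size C))) }
  where
  #products≤size : ∀ {c ℓ₁ ℓ₂} {F : HeytingField c ℓ₁ ℓ₂} {N} (C : ΣΠΣCircuit F N) →
                   ΣΠΣCircuit.#products C ≤ ΣΠΣCircuit.size C
  #products≤size C = ℕₚ.≤-trans (ℕₚ.m≤n+m #products (#inputs ℕ.+ #sums)) (ℕₚ.m≤m+n _ 1)
    where open ΣΠΣCircuit C
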